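{- Let $G$ and $H$ be two digraphs. Then $\lambda_2(G\Box H)\ge \lambda_2(G)+\lambda_2(H)$. Moreover, the bound is sharp.
   Context: Digraphs are finite, without loops or parallel arcs. The Cartesian product $G\Box H$ has vertex set $V(G)\times V(H)$ and an arc from $(x,x')$ to $(y,y')$ iff either $xy\in A(G)$ and $x'=y'$, or $x=y$ and $x'y'\in A(H)$. For a digraph $D$ and $S\subseteq V(D)$, $\lambda_S(D)$ is the maximum number of pairwise arc-disjoint strong subgraphs of $D$ containing $S$, and $\lambda_2(D)=\min\{\lambda_S(D): S\subseteq V(D), |S|=2\}$.
   Formalization: The inequality is stated for G and H of order at least 2 that are both strong or both not strong; if exactly one is strong it fails, since then λ₂(G□H)=0 while λ₂(G)+λ₂(H)≥1 (e.g. a 2-cycle and two isolated vertices). -}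

module Defs where

open import Data.Empty using (⊥-elim)
open import Data.Fin.Base using (Fin; zero; suc; toℕ; fromℕ<; remQuot)
open import Data.Fin.Properties using (any?; all?; toℕ<n; toℕ-injective; toℕ-fromℕ<; injective⇒≤) renaming (_≟_ to _≟ᶠ_; suc-injective to suc-injectiveᶠ)
open import Data.Fin.Subset using (Subset; _∈_; _⊆_; ∣_∣; ⊤; ⊥; inside; outside)
open import Data.Fin.Subset.Properties using (_∈?_; _⊆?_; anySubset?; ∣⊥∣≡0)
open import Data.Nat.Base using (ℕ; zero; suc; _+_; _*_; _≤_; _<_; z≤n; 2+; NonTrivial; nonTrivial⇒nonZero)
open import Data.Nat.Properties using (_≟_; ≤-refl; ≤-trans; n≤1+n; m≤n⇒m<n∨m≡n; ≤-pred; ≤∧≢⇒<; +-identityʳ; +-suc; n≢0∧m>1⇒m*n>1; suc-injective)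
open import Data.Product using (Σ; ∃; _×_; _,_; proj₁; proj₂; Σ-syntax; ∃-syntax)
open import Data.Sum using (_⊎_; inj₁; inj₂)
open import Data.Vec.Base using (Vec; []; _∷_; lookup; here; there)
open import Level using (0ℓ)
open import Relation.Binary using (Rel; Decidable; Irreflexive)
open import Relation.Binary.Construct.Closure.ReflexiveTransitive using (Star; ε; _◅_; _◅◅_)
open import Relation.Binary.PropositionalEquality using (_≡_; _≢_; refl; sym; trans; cong; subst)
open import Relation.Nullary using (¬_; Dec; yes; no)
open import Relation.Nullary.Decidable using (map′; recompute; _×-dec_; _⊎-dec_; _→-dec_; ¬?)
open import Relation.Unary using (Pred) renaming (Decidable to Decidable₁)

------------------------------------------------------------------------
-- Digraphs and their Cartesian product

record Digraph : Set₁ where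
  field
    order   : ℕ
    Arc     : Rel (Fin order) 0ℓ
    arc?    : Decidable Arc
    no-loop : Irreflexive _≡_ Arc

open Digraph public

infixr 7 _□_

-- The vertex set Fin (m * n) stands for Fin m × Fin n through the bijection
-- remQuot.
_□_ : Digraph → Digraph → Digraph
G □ H = record
  { order   = order G * order H
  ; Arc     = λ p q → □-Arc (pair p) (pair q)
  ; arc?    = λ p q → □-arc? (pair p) (pair q)
  ; no-loop = λ { {p} refl → □-no-loop (pair p) }
  }
  where
  V = Fin (order G) × Fin (order H)

  pair : Fin (order G * order H) → V
  pair = remQuot (order H)

  □-Arc : Rel V 0ℓ
  □-Arc (x , x′) (y , y′) = (Arc G x y × x′ ≡ y′) ⊎ (x ≡ y × Arc H x′ y′)

  □-arc? : Decidable □-Arc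
  □-arc? (x , x′) (y , y′) =
    (arc? G x y ×-dec (x′ ≟ᶠ y′)) ⊎-dec ((x ≟ᶠ y) ×-dec arc? H x′ y′)

  □-no-loop : ∀ v → ¬ □-Arc v v
  □-no-loop _ (inj₁ (a , _)) = no-loop G refl a
  □-no-loop _ (inj₂ (_ , a)) = no-loop H refl a

instance
  *-nonTrivial : ∀ {m n} .{{_ : NonTrivial m}} .{{_ : NonTrivial n}} → NonTrivial (m * n)
  *-nonTrivial {m} {n} = n≢0∧m>1⇒m*n>1 m n {{nonTrivial⇒nonZero n}}

------------------------------------------------------------------------
-- Strong subgraphs

StronglyConnected : ∀ {n} → Subset n → Rel (Fin n) 0ℓ → Set
StronglyConnected X R = ∀ u v → u ∈ X → v ∈ X → Star R u v

-- G □ H is strong iff both factors are, and λ₂ D ≥ 1 iff D is strong, so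
-- λ₂ (G □ H) ≥ λ₂ G + λ₂ H fails whenever exactly one of G and H is strong:
-- the right-hand side is positive and the left-hand side is 0.
Strong : Digraph → Set
Strong D = StronglyConnected ⊤ (Arc D)

-- A set of vertices together with a set of ordered pairs, the latter stored
-- as out-neighbourhoods.
record Part (n : ℕ) : Set where
  constructor part
  field
    vertices : Subset n
    outs     : Vec (Subset n) n

open Part public

_∋_⟶_ : ∀ {n} → Part n → Fin n → Fin n → Set
F ∋ u ⟶ v = v ∈ lookup (outs F) u

IsSubgraph : (D : Digraph) → Part (order D) → Set
IsSubgraph D F = ∀ u v → F ∋ u ⟶ v → Arc D u v × u ∈ vertices F × v ∈ vertices F

IsStrongSubgraph : (D : Digraph) → Part (order D) → Set
IsStrongSubgraph D F = IsSubgraph D F × StronglyConnected (vertices F) (F ∋_⟶_)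

ArcDisjoint : ∀ {n} → Part n → Part n → Set
ArcDisjoint F F′ = ∀ u v → ¬ (F ∋ u ⟶ v × F′ ∋ u ⟶ v)

-- k pairwise arc-disjoint strong subgraphs of D containing S.  If S has at
-- least two vertices, arc-disjointness forces the members to be distinct.
IsPacking : (D : Digraph) → Subset (order D) → ∀ {k} → Vec (Part (order D)) k → Set
IsPacking D S Fs =
  (∀ i → IsStrongSubgraph D (lookup Fs i) × S ⊆ vertices (lookup Fs i)) ×
  (∀ i j → i ≢ j → ArcDisjoint (lookup Fs i) (lookup Fs j))

Packing : (D : Digraph) → Subset (order D) → ℕ → Set
Packing D S k = Σ[ Fs ∈ Vec (Part (order D)) k ] IsPacking D S Fs

IsMaximum IsMinimum : (ℕ → Set) → ℕ → Set
IsMaximum P k = P k × (∀ m → P m → m ≤ k)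
IsMinimum P k = P k × (∀ m → P m → k ≤ m)

------------------------------------------------------------------------
-- Existence of the maximum defining λ_S: packings are decidable, and their
-- size is at most the order because they use distinct arcs out of a vertex
-- of S.

private

  Searchable : Set → Set₁
  Searchable A = (P : Pred A 0ℓ) → Decidable₁ P → Dec (∃ P)

  search-Subset : ∀ {n} → Searchable (Subset n)
  search-Subset P P? = anySubset? P?

  search-Vec : ∀ {A} → Searchable A → ∀ k → Searchable (Vec A k)
  search-Vec s zero P P? =
    map′ (λ p → [] , p) (λ { ([] , p) → p }) (P? [])
  search-Vec s (suc k) P P? =
    map′ (λ { (x , xs , p) → x ∷ xs , p }) (λ { (x ∷ xs , p) → x , xs , p })
      (s (λ x → ∃ λ xs → P (x ∷ xs))
         (λ x → search-Vec s k (λ xs → P (x ∷ xs)) (λ xs → P? (x ∷ xs))))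

  search-Part : ∀ {n} → Searchable (Part n)
  search-Part {n} P P? =
    map′ (λ { (X , A , p) → part X A , p }) (λ { (part X A , p) → X , A , p })
      (search-Subset (λ X → ∃ λ A → P (part X A))
         (λ X → search-Vec search-Subset n (λ A → P (part X A)) (λ A → P? (part X A))))

  -- Floyd–Warshall: reachability with all inner vertices of index below k.
  module Reachability {n} {R : Rel (Fin n) 0ℓ} (R? : Decidable R) where

    Via : ∀ k → k ≤ n → Rel (Fin n) 0ℓ
    Via zero    _   u v = u ≡ v ⊎ R u v
    Via (suc k) k<n u v =
      Via k (≤-trans (n≤1+n k) k<n) u v ⊎
      (Via k (≤-trans (n≤1+n k) k<n) u (fromℕ< k<n) × Via k (≤-trans (n≤1+n k) k<n) (fromℕ< k<n) v)

    via? : ∀ k k≤n → Decidable (Via k k≤n)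
    via? zero    _   u v = (u ≟ᶠ v) ⊎-dec R? u v
    via? (suc k) k<n u v =
      via? k _ u v ⊎-dec (via? k _ u (fromℕ< k<n) ×-dec via? k _ (fromℕ< k<n) v)

    sound : ∀ k k≤n {u v} → Via k k≤n u v → Star R u v
    sound zero    _ (inj₁ refl)    = ε
    sound zero    _ (inj₂ r)       = r ◅ ε
    sound (suc k) _ (inj₁ p)       = sound k _ p
    sound (suc k) _ (inj₂ (p , q)) = sound k _ p ◅◅ sound k _ q

    weaken : ∀ k k≤n {u v} → u ≡ v ⊎ R u v → Via k k≤n u v
    weaken zero    _ p = p
    weaken (suc k) _ p = inj₁ (weaken k _ p)

    join : ∀ k k≤n {u v} w → toℕ w < k → Via k k≤n u w → Via k k≤n w v → Via k k≤n u v
    join (suc k) k<n {u} {v} w w<1+k p q with m≤n⇒m<n∨m≡n (≤-pred w<1+k)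
    ... | inj₁ w<k = low p q
      where
      low : Via (suc k) k<n u w → Via (suc k) k<n w v → Via (suc k) k<n u v
      low (inj₁ a)       (inj₁ b)       = inj₁ (join k _ w w<k a b)
      low (inj₁ a)       (inj₂ (b , c)) = inj₂ (join k _ w w<k a b , c)
      low (inj₂ (a , b)) (inj₁ c)       = inj₂ (a , join k _ w w<k b c)
      low (inj₂ (a , _)) (inj₂ (_ , c)) = inj₂ (a , c)
    ... | inj₂ w≡k = inj₂ (to p , from q)
      where
      w≡ : w ≡ fromℕ< k<n
      w≡ = toℕ-injective (trans w≡k (sym (toℕ-fromℕ< k<n)))
      to : Via (suc k) k<n u w → Via k _ u (fromℕ< k<n)
      to (inj₁ a)       = subst (Via k _ u) w≡ a
      to (inj₂ (a , _)) = a
      from : Via (suc k) k<n w v → Via k _ (fromℕ< k<n) v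
      from (inj₁ a)       = subst (λ z → Via k _ z v) w≡ a
      from (inj₂ (_ , a)) = a

    complete : ∀ {u v} → Star R u v → Via n ≤-refl u v
    complete ε             = weaken n _ (inj₁ refl)
    complete (_◅_ {j = w} r rs) = join n _ w (toℕ<n w) (weaken n _ (inj₂ r)) (complete rs)

    star? : Decidable (Star R)
    star? u v = map′ (sound n ≤-refl) complete (via? n ≤-refl u v)

  stronglyConnected? : ∀ {n} (X : Subset n) {R : Rel (Fin n) 0ℓ} → Decidable R →
                       Dec (StronglyConnected X R)
  stronglyConnected? X R? = all? λ u → all? λ v →
    (u ∈? X) →-dec ((v ∈? X) →-dec Reachability.star? R? u v)

  arcOf? : ∀ {n} (F : Part n) → Decidable (F ∋_⟶_)
  arcOf? F u v = v ∈? lookup (outs F) u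

  isSubgraph? : ∀ D → Decidable₁ (IsSubgraph D)
  isSubgraph? D F = all? λ u → all? λ v →
    arcOf? F u v →-dec (arc? D u v ×-dec ((u ∈? vertices F) ×-dec (v ∈? vertices F)))

  isPacking? : ∀ D S {k} → Decidable₁ (IsPacking D S {k})
  isPacking? D S Fs =
    (all? λ i → (isSubgraph? D (lookup Fs i) ×-dec
                 stronglyConnected? (vertices (lookup Fs i)) (arcOf? (lookup Fs i))) ×-dec
                (S ⊆? vertices (lookup Fs i))) ×-dec
    (all? λ i → all? λ j → ¬? (i ≟ᶠ j) →-dec
      (all? λ u → all? λ v → ¬? (arcOf? (lookup Fs i) u v ×-dec arcOf? (lookup Fs j) u v)))

  packing? : ∀ D S → Decidable₁ (Packing D S)
  packing? D S k = search-Vec search-Part k (IsPacking D S) (isPacking? D S)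

  member : ∀ {n k} (S : Subset n) → ∣ S ∣ ≡ suc k → ∃[ u ] u ∈ S
  member (inside  ∷ S) _  = zero , here
  member (outside ∷ S) eq = let u , u∈S = member S eq in suc u , there u∈S

  two-members : ∀ {n} (S : Subset n) → ∣ S ∣ ≡ 2 → ∃[ u ] ∃[ v ] (u ∈ S × v ∈ S × u ≢ v)
  two-members (inside  ∷ S) eq =
    let v , v∈S = member S (suc-injective eq) in zero , suc v , here , there v∈S , λ ()
  two-members (outside ∷ S) eq =
    let u , v , u∈S , v∈S , u≢v = two-members S eq
    in suc u , suc v , there u∈S , there v∈S , λ eq′ → u≢v (suc-injectiveᶠ eq′)

  first-arc : ∀ {n} {R : Rel (Fin n) 0ℓ} {u v} → u ≢ v → Star R u v → ∃[ w ] R u w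
  first-arc u≢v ε       = ⊥-elim (u≢v refl)
  first-arc _   (r ◅ _) = _ , r

  packing-bound : ∀ D S → ∣ S ∣ ≡ 2 → ∀ k → Packing D S k → k ≤ order D
  packing-bound D S ∣S∣≡2 k (Fs , ok , disj) with two-members S ∣S∣≡2
  ... | u , v , u∈S , v∈S , u≢v = injective⇒≤ {f = λ i → proj₁ (out i)} inj
    where
    out : ∀ i → ∃[ w ] (lookup Fs i ∋ u ⟶ w)
    out i = let (_ , strong) , S⊆F = ok i in
            first-arc u≢v (strong u v (S⊆F u∈S) (S⊆F v∈S))
    inj : ∀ {i j} → proj₁ (out i) ≡ proj₁ (out j) → i ≡ j
    inj {i} {j} eq with i ≟ᶠ j
    ... | yes i≡j = i≡j
    ... | no  i≢j = ⊥-elim (disj i j i≢j u (proj₁ (out i))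
      (proj₂ (out i) , subst (λ w → lookup Fs j ∋ u ⟶ w) (sym eq) (proj₂ (out j))))

  maximum : ∀ {P} → Decidable₁ P → P 0 → ∀ b → (∀ m → P m → m ≤ b) → ∃ (IsMaximum P)
  maximum P? p₀ zero    bound = 0 , p₀ , bound
  maximum P? p₀ (suc b) bound with P? (suc b)
  ... | yes p = suc b , p , bound
  ... | no ¬p = maximum P? p₀ b λ m pm → ≤-pred (≤∧≢⇒< (bound m pm) λ { refl → ¬p pm })

  minimum : ∀ {P} → Decidable₁ P → ∀ b → P b → ∃ (IsMinimum P)
  minimum {P} P? b pb = go b 0 (λ _ _ → z≤n) (subst P (sym (+-identityʳ b)) pb)
    where
    go : ∀ d k → (∀ m → P m → k ≤ m) → P (d + k) → ∃ (IsMinimum P)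
    go zero    k low p = k , p , low
    go (suc d) k low p with P? k
    ... | yes pk = k , pk , low
    ... | no ¬pk = go d (suc k) (λ m pm → ≤∧≢⇒< (low m pm) λ { refl → ¬pk pm })
                     (subst P (sym (+-suc d k)) p)

abstract
  λₛ-exists : ∀ D S → .(∣ S ∣ ≡ 2) → ∃ (IsMaximum (Packing D S))
  λₛ-exists D S ∣S∣≡2 =
    maximum (packing? D S) ([] , (λ ()) , (λ ())) (order D)
      (packing-bound D S (recompute (∣ S ∣ ≟ 2) ∣S∣≡2))

-- λ_S(D), needed only for ∣ S ∣ ≡ 2; for a singleton S the maximum need not
-- exist, since the arcless one-vertex subgraph is arc-disjoint from itself.
λₛ : (D : Digraph) (S : Subset (order D)) → .(∣ S ∣ ≡ 2) → ℕ
λₛ D S ∣S∣≡2 = proj₁ (λₛ-exists D S ∣S∣≡2)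

λₛ-isMaximum : ∀ D S .(∣S∣≡2 : ∣ S ∣ ≡ 2) → IsMaximum (Packing D S) (λₛ D S ∣S∣≡2)
λₛ-isMaximum D S ∣S∣≡2 = proj₂ (λₛ-exists D S ∣S∣≡2)

Isλₛ-value : Digraph → ℕ → Set
Isλₛ-value D k = ∃[ S ] Σ[ ∣S∣≡2 ∈ ∣ S ∣ ≡ 2 ] λₛ D S ∣S∣≡2 ≡ k

private

  isλₛ-value? : ∀ D → Decidable₁ (Isλₛ-value D)
  isλₛ-value? D k = anySubset? dec
    where
    dec : ∀ S → Dec (Σ[ ∣S∣≡2 ∈ ∣ S ∣ ≡ 2 ] λₛ D S ∣S∣≡2 ≡ k)
    dec S with ∣ S ∣ ≟ 2
    ... | no  ≢2 = no λ (≡2 , _) → ≢2 ≡2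
    ... | yes ≡2 = map′ (λ eq → ≡2 , eq) proj₂ (λₛ D S ≡2 ≟ k)

  some-pair : ∀ n .{{_ : NonTrivial n}} → Σ[ S ∈ Subset n ] ∣ S ∣ ≡ 2
  some-pair (2+ n) = inside ∷ inside ∷ ⊥ , cong 2+ (∣⊥∣≡0 n)

abstract
  λ₂-exists : ∀ D .{{_ : NonTrivial (order D)}} → ∃ (IsMinimum (Isλₛ-value D))
  λ₂-exists D = minimum (isλₛ-value? D) _
    (let S , ∣S∣≡2 = some-pair (order D) in S , ∣S∣≡2 , refl)

-- The minimum ranges over a nonempty set exactly when D has order at least 2,
-- which is what NonTrivial says.
λ₂ : (D : Digraph) .{{_ : NonTrivial (order D)}} → ℕ
λ₂ D = proj₁ (λ₂-exists D)

λ₂-isMinimum : ∀ D .{{_ : NonTrivial (order D)}} → IsMinimum (Isλₛ-value D) (λ₂ D)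
λ₂-isMinimum D = proj₂ (λ₂-exists D)

{-# OPTIONS --safe #-}

-- Both digraphs may be assumed strong, since otherwise both λ₂ vanish.  Let
-- F_i (i ≤ λ₂ G) and K_j (j ≤ λ₂ H) be packings of the factors, and let S
-- consist of (x , x′) and (y , y′).
--
-- If x ≡ y, the copies of the K_j in the fibre over x contain S.  Let x ⟶ z_i
-- be an arc of F_i, where F_i contains x and some other vertex; arc-disjointness
-- makes the z_i distinct.  The copies of F_i at heights x′ and y′, joined by
-- the fibre of H over z_i, give the remaining subgraphs.
--
-- If x ≢ y and x′ ≢ y′, the same bridging works for F_i whenever z_i ≢ y and
-- symmetrically for K_j, so it can fail for only one F_i and one K_j.  Those
-- two are combined instead: F at height x′ with K over y, and F at height y′
-- with K over x, are strong subgraphs containing S that need no bridge.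

module Submission where

open import Defs
open import Data.Empty using (⊥-elim) renaming (⊥ to ∅)
open import Data.Fin.Base using (Fin; zero; suc; inject≤)
open import Data.Fin.Patterns using (0F; 1F; 2F; 3F)
open import Data.Fin.Permutation using (transpose)
open import Data.Fin.Properties using (_≟_; any?; *↔×; +↔⊎; inject≤-injective; injective⇒≤) renaming (suc-injective to suc-injectiveᶠ)
open import Data.Fin.Subset using (Subset; _∈_; _∪_; ∣_∣; ⁅_⁆; ⊥; inside; outside)
open import Data.Fin.Subset.Properties using (∈⊤; x∈⁅x⁆; x∈⁅y⁆⇒x≡y; ∣⁅x⁆∣≡1; x∈p∪q⁺; x∈p∪q⁻; ∪-identityˡ; ∪-identityʳ; _∈?_)
open import Data.Nat.Base using (zero; suc; 2+; _+_; _≤_; _≥_; z≤n; s≤s; NonTrivial)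
open import Data.Nat.Properties using (≤-antisym; ≤-pred; ≤-trans; +-mono-≤; ≰⇒>; _≤?_; suc-injective)
open import Data.Product using (Σ-syntax; ∃-syntax; _×_; _,_; proj₁; proj₂; swap)
open import Data.Product.Algebra using (×-comm)
open import Data.Sum using (_⊎_; inj₁; inj₂) renaming (map to ⊎-map)
open import Data.Sum.Algebra using (⊎-comm)
open import Data.Unit using (tt) renaming (⊤ to Unit)
open import Data.Vec.Base using ([]; _∷_; lookup; tabulate)
open import Data.Vec.Properties using (lookup∘tabulate; lookup⇒[]=; []=⇒lookup)
open import Function.Base using (_∘_; id)
open import Function.Bundles using (_⇔_; _↔_; _↣_; mk↣; Inverse; Injection; Equivalence)
open import Function.Properties.Inverse using (↔⇒↣)
open import Level using (0ℓ)
open import Relation.Binary using (Rel; Decidable)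
open import Relation.Binary.Construct.Closure.ReflexiveTransitive using (Star; ε; _◅_; _◅◅_; gmap) renaming (map to Star-map)
open import Relation.Binary.PropositionalEquality using (_≡_; _≢_; refl; sym; trans; cong; subst; subst₂)
open import Relation.Nullary using (¬_; yes; no; does)
open import Relation.Nullary.Decidable using (dec-true; _×-dec_; _⊎-dec_; ¬?)
open import Relation.Unary using (Pred) renaming (Decidable to Decidable₁)

private
  variable
    X Y I J : Set
    E : Rel X 0ℓ
    u v : X

-- Subsets of Fin n

∣p∣≡0⇒p≡⊥ : ∀ {n} (p : Subset n) → ∣ p ∣ ≡ 0 → p ≡ ⊥
∣p∣≡0⇒p≡⊥ []            _  = refl
∣p∣≡0⇒p≡⊥ (outside ∷ p) eq = cong (outside ∷_) (∣p∣≡0⇒p≡⊥ p eq)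

∣p∣≡1⇒p≡⁅x⁆ : ∀ {n} (p : Subset n) → ∣ p ∣ ≡ 1 → ∃[ x ] p ≡ ⁅ x ⁆
∣p∣≡1⇒p≡⁅x⁆ (inside  ∷ p) eq = zero , cong (inside ∷_) (∣p∣≡0⇒p≡⊥ p (suc-injective eq))
∣p∣≡1⇒p≡⁅x⁆ (outside ∷ p) eq =
  let x , p≡ = ∣p∣≡1⇒p≡⁅x⁆ p eq in suc x , cong (outside ∷_) p≡

-- Lets the two-element sets in the definition of `λ₂` be replaced by pairs of distinct vertices.
∣p∣≡2⇒p≡⁅x⁆∪⁅y⁆ : ∀ {n} (p : Subset n) → ∣ p ∣ ≡ 2 → ∃[ x ] ∃[ y ] (x ≢ y × p ≡ ⁅ x ⁆ ∪ ⁅ y ⁆)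
∣p∣≡2⇒p≡⁅x⁆∪⁅y⁆ (inside ∷ p) eq =
  let y , p≡ = ∣p∣≡1⇒p≡⁅x⁆ p (suc-injective eq)
  in zero , suc y , (λ ()) , cong (inside ∷_) (trans p≡ (sym (∪-identityˡ ⁅ y ⁆)))
∣p∣≡2⇒p≡⁅x⁆∪⁅y⁆ (outside ∷ p) eq =
  let x , y , x≢y , p≡ = ∣p∣≡2⇒p≡⁅x⁆∪⁅y⁆ p eq
  in suc x , suc y , x≢y ∘ suc-injectiveᶠ , cong (outside ∷_) p≡

x≢y⇒∣⁅x⁆∪⁅y⁆∣≡2 : ∀ {n} (x y : Fin n) → x ≢ y → ∣ ⁅ x ⁆ ∪ ⁅ y ⁆ ∣ ≡ 2
x≢y⇒∣⁅x⁆∪⁅y⁆∣≡2 zero    zero    x≢y = ⊥-elim (x≢y refl)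
x≢y⇒∣⁅x⁆∪⁅y⁆∣≡2 zero    (suc y) _   = cong suc (trans (cong ∣_∣ (∪-identityˡ ⁅ y ⁆)) (∣⁅x⁆∣≡1 y))
x≢y⇒∣⁅x⁆∪⁅y⁆∣≡2 (suc x) zero    _   = cong suc (trans (cong ∣_∣ (∪-identityʳ ⁅ x ⁆)) (∣⁅x⁆∣≡1 x))
x≢y⇒∣⁅x⁆∪⁅y⁆∣≡2 (suc x) (suc y) x≢y = x≢y⇒∣⁅x⁆∪⁅y⁆∣≡2 x y (x≢y ∘ cong suc)

comprehension : ∀ {n} {P : Pred (Fin n) 0ℓ} → Decidable₁ P → Subset n
comprehension P? = tabulate (does ∘ P?)

module _ {n} {P : Pred (Fin n) 0ℓ} (P? : Decidable₁ P) where

  ∈-comprehension⁺ : ∀ {x} → P x → x ∈ comprehension P?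
  ∈-comprehension⁺ {x} px =
    lookup⇒[]= x _ (trans (lookup∘tabulate (does ∘ P?) x) (dec-true (P? x) px))

  ∈-comprehension⁻ : ∀ {x} → x ∈ comprehension P? → P x
  ∈-comprehension⁻ {x} x∈ with P? x | trans (sym (lookup∘tabulate (does ∘ P?) x)) ([]=⇒lookup x∈)
  ... | yes px | _ = px

other-vertex : ∀ {n} .{{_ : NonTrivial n}} (x : Fin n) → ∃[ y ] x ≢ y
other-vertex {2+ n} zero    = suc zero , λ ()
other-vertex {2+ n} (suc x) = zero , λ ()

-- Strong subgraphs and arc-disjoint packings, over an arbitrary vertex type

-- Predicates in place of `Part` allow work on pairs of vertices directly; decidability is what lets
-- `toPart` tabulate them.
record StrongSubgraph {X : Set} (E : Rel X 0ℓ) : Set₁ where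
  field
    V      : Pred X 0ℓ
    A      : Rel X 0ℓ
    V?     : Decidable₁ V
    A?     : Decidable A
    arc    : ∀ {u v} → A u v → E u v
    source : ∀ {u v} → A u v → V u
    target : ∀ {u v} → A u v → V v
    strong : ∀ {u v} → V u → V v → Star A u v

open StrongSubgraph

-- `disjoint` is stated positively, so that it follows from showing that each arc determines the
-- index of its member.
record ArcDisjointPacking {X : Set} (E : Rel X 0ℓ) (u v : X) (I : Set) : Set₁ where
  field
    member   : I → StrongSubgraph E
    left     : ∀ i → V (member i) u
    right    : ∀ i → V (member i) v
    disjoint : ∀ {i j p q} → A (member i) p q → A (member j) p q → i ≡ j

open ArcDisjointPacking

whole : ∀ D → Strong D → StrongSubgraph (Arc D)
whole D s = record
  { V = λ _ → Unit ; A = Arc D ; V? = λ _ → yes tt ; A? = arc? D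
  ; arc = id ; source = λ _ → tt ; target = λ _ → tt
  ; strong = λ _ _ → s _ _ ∈⊤ ∈⊤
  }

-- Any two vertices of the union are connected by a walk through the common vertex `w`.
join-at : ∀ w (F F′ : StrongSubgraph E) → V F w → V F′ w → StrongSubgraph E
join-at w F F′ w∈F w∈F′ = record
  { V  = λ u → V F u ⊎ V F′ u
  ; A  = λ u v → A F u v ⊎ A F′ u v
  ; V? = λ u → V? F u ⊎-dec V? F′ u
  ; A? = λ u v → A? F u v ⊎-dec A? F′ u v
  ; arc    = λ { (inj₁ a) → arc F a ; (inj₂ a) → arc F′ a }
  ; source = ⊎-map (source F) (source F′)
  ; target = ⊎-map (target F) (target F′)
  ; strong = λ p q → to p ◅◅ from q
  }
  where
  to : ∀ {u} → V F u ⊎ V F′ u → Star (λ u v → A F u v ⊎ A F′ u v) u w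
  to (inj₁ p) = Star-map inj₁ (strong F p w∈F)
  to (inj₂ p) = Star-map inj₂ (strong F′ p w∈F′)
  from : ∀ {u} → V F u ⊎ V F′ u → Star (λ u v → A F u v ⊎ A F′ u v) w u
  from (inj₁ p) = Star-map inj₁ (strong F w∈F p)
  from (inj₂ p) = Star-map inj₂ (strong F′ w∈F′ p)

module _ {E : Rel X 0ℓ} {E′ : Rel Y 0ℓ} (φ : X ↔ Y) where

  open Inverse φ using (to; from; strictlyInverseˡ; strictlyInverseʳ)

  -- Serves both to exchange the two factors and to pass from pairs to `Fin (m * n)`.
  pullback : (∀ {u v} → E′ (to u) (to v) → E u v) → StrongSubgraph E′ → StrongSubgraph E
  pullback reflects F = record
    { V  = V F ∘ to
    ; A  = λ u v → A F (to u) (to v)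
    ; V? = V? F ∘ to
    ; A? = λ u v → A? F (to u) (to v)
    ; arc    = reflects ∘ arc F
    ; source = source F
    ; target = target F
    ; strong = λ {u} {v} p q →
        subst₂ (Star _) (strictlyInverseʳ u) (strictlyInverseʳ v)
          (gmap from (subst₂ (A F) (sym (strictlyInverseˡ _)) (sym (strictlyInverseˡ _)))
            (strong F p q))
    }

  pullback-packing : (∀ {u v} → E′ (to u) (to v) → E u v) →
                     ArcDisjointPacking E′ (to u) (to v) I → ArcDisjointPacking E u v I
  pullback-packing reflects P = record
    { member   = pullback reflects ∘ member P
    ; left     = left P
    ; right    = right P
    ; disjoint = disjoint P
    }

reindex : I ↣ J → ArcDisjointPacking E u v J → ArcDisjointPacking E u v I
reindex f P = record
  { member   = member P ∘ Injection.to f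
  ; left     = left P ∘ Injection.to f
  ; right    = right P ∘ Injection.to f
  ; disjoint = λ a b → Injection.injective f (disjoint P a b)
  }

-- By arc-disjointness at most one member contains the arc from `u` to `v`; a transposition moves it
-- to index `zero`.
isolate-arc : ∀ {a} (P : ArcDisjointPacking E u v (Fin (suc a))) →
              Σ[ Q ∈ ArcDisjointPacking E u v (Fin (suc a)) ] (∀ i → ¬ A (member Q (suc i)) u v)
isolate-arc {u = u} {v = v} P with any? (λ i → A? (member P i) u v)
... | no  ∄       = P , λ i a → ∄ (suc i , a)
... | yes (k , a) = reindex π P , λ i b → zero≢suc (Injection.injective π (disjoint P a b))
  where
  π = ↔⇒↣ (transpose zero k)
  zero≢suc : ∀ {n} {i : Fin n} → zero ≢ suc i
  zero≢suc ()

first-step : {R : Rel X 0ℓ} → u ≢ v → Star R u v → ∃[ w ] R u w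
first-step u≢v ε       = ⊥-elim (u≢v refl)
first-step _   (r ◅ _) = _ , r

module OutNeighbours {u v : X} (u≢v : u ≢ v) (P : ArcDisjointPacking E u v I) where

  out-arc : ∀ i → ∃[ w ] A (member P i) u w
  out-arc i = first-step u≢v (strong (member P i) (left P i) (right P i))

  out : I → X
  out i = proj₁ (out-arc i)

  out∈ : ∀ i → V (member P i) (out i)
  out∈ i = target (member P i) (proj₂ (out-arc i))

  out-arc∈E : ∀ i → E u (out i)
  out-arc∈E i = arc (member P i) (proj₂ (out-arc i))

  out-injective : ∀ {i j} → out i ≡ out j → i ≡ j
  out-injective {i} {j} eq =
    disjoint P (proj₂ (out-arc i)) (subst (A (member P j) u) (sym eq) (proj₂ (out-arc j)))

-- Packings and λ₂

module _ {D : Digraph} where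

  fromPart : (F : Part (order D)) → IsStrongSubgraph D F → StrongSubgraph (Arc D)
  fromPart F (sub , conn) = record
    { V  = _∈ vertices F
    ; A  = F ∋_⟶_
    ; V? = _∈? vertices F
    ; A? = λ u v → v ∈? lookup (outs F) u
    ; arc    = λ a → proj₁ (sub _ _ a)
    ; source = λ a → proj₁ (proj₂ (sub _ _ a))
    ; target = λ a → proj₂ (proj₂ (sub _ _ a))
    ; strong = conn _ _
    }

  fromPacking : ∀ {S k u v} → u ∈ S → v ∈ S → Packing D S k → ArcDisjointPacking (Arc D) u v (Fin k)
  fromPacking u∈S v∈S (Fs , ok , disj) = record
    { member   = λ i → fromPart (lookup Fs i) (proj₁ (ok i))
    ; left     = λ i → proj₂ (ok i) u∈S
    ; right    = λ i → proj₂ (ok i) v∈S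
    ; disjoint = same
    }
    where
    same : ∀ {i j p q} → lookup Fs i ∋ p ⟶ q → lookup Fs j ∋ p ⟶ q → i ≡ j
    same {i} {j} a b with i ≟ j
    ... | yes i≡j = i≡j
    ... | no  i≢j = ⊥-elim (disj i j i≢j _ _ (a , b))

  toPart : StrongSubgraph (Arc D) → Part (order D)
  toPart F = part (comprehension (V? F)) (tabulate (λ u → comprehension (A? F u)))

  module _ (F : StrongSubgraph (Arc D)) where

    toPart-arc⁺ : ∀ {u v} → A F u v → toPart F ∋ u ⟶ v
    toPart-arc⁺ {u} {v} a = subst (v ∈_) (sym (lookup∘tabulate _ u)) (∈-comprehension⁺ (A? F u) a)

    toPart-arc⁻ : ∀ {u v} → toPart F ∋ u ⟶ v → A F u v
    toPart-arc⁻ {u} {v} a = ∈-comprehension⁻ (A? F u) (subst (v ∈_) (lookup∘tabulate _ u) a)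

    toPart-isStrong : IsStrongSubgraph D (toPart F)
    toPart-isStrong =
      (λ u v a → let a′ = toPart-arc⁻ a in
         arc F a′ , ∈-comprehension⁺ (V? F) (source F a′) , ∈-comprehension⁺ (V? F) (target F a′)) ,
      (λ u v p q → Star-map toPart-arc⁺
         (strong F (∈-comprehension⁻ (V? F) p) (∈-comprehension⁻ (V? F) q)))

  toPacking : ∀ {k u v} → ArcDisjointPacking (Arc D) u v (Fin k) → Packing D (⁅ u ⁆ ∪ ⁅ v ⁆) k
  toPacking {k} {u} {v} P = tabulate parts ,
    (λ i → subst Good (sym (lookup∘tabulate parts i)) (good i)) ,
    (λ i j i≢j p q (a , b) → i≢j (disjoint P (arc-of i a) (arc-of j b)))
    where
    parts : Fin k → Part (order D)
    parts = toPart ∘ member P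
    Good : Part (order D) → Set
    Good F = IsStrongSubgraph D F × (∀ {w} → w ∈ ⁅ u ⁆ ∪ ⁅ v ⁆ → w ∈ vertices F)
    good : ∀ i → Good (parts i)
    good i = toPart-isStrong (member P i) , λ w∈ → ∈-comprehension⁺ (V? (member P i)) (contains w∈)
      where
      contains : ∀ {w} → w ∈ ⁅ u ⁆ ∪ ⁅ v ⁆ → V (member P i) w
      contains w∈ with x∈p∪q⁻ ⁅ u ⁆ ⁅ v ⁆ w∈
      ... | inj₁ w∈u = subst (V (member P i)) (sym (x∈⁅y⁆⇒x≡y u w∈u)) (left P i)
      ... | inj₂ w∈v = subst (V (member P i)) (sym (x∈⁅y⁆⇒x≡y v w∈v)) (right P i)
    arc-of : ∀ i {p q} → lookup (tabulate parts) i ∋ p ⟶ q → A (member P i) p q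
    arc-of i a = toPart-arc⁻ (member P i) (subst (_∋ _ ⟶ _) (lookup∘tabulate parts i) a)

module _ (D : Digraph) .{{_ : NonTrivial (order D)}} where

  -- A maximum packing for the pair has `λₛ` members, at least `λ₂ D`, and is truncated along
  -- `inject≤`.
  λ₂-packing : ∀ u v → u ≢ v → ArcDisjointPacking (Arc D) u v (Fin (λ₂ D))
  λ₂-packing u v u≢v = reindex (mk↣ (inject≤-injective λ₂≤λₛ λ₂≤λₛ _ _))
    (fromPacking {D} (x∈p∪q⁺ (inj₁ (x∈⁅x⁆ u))) (x∈p∪q⁺ (inj₂ (x∈⁅x⁆ v)))
      (proj₁ (λₛ-isMaximum D S ∣S∣≡2)))
    where
    S = ⁅ u ⁆ ∪ ⁅ v ⁆
    ∣S∣≡2 = x≢y⇒∣⁅x⁆∪⁅y⁆∣≡2 u v u≢v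
    λ₂≤λₛ : λ₂ D ≤ λₛ D S ∣S∣≡2
    λ₂≤λₛ = proj₂ (λ₂-isMinimum D) _ (S , ∣S∣≡2 , refl)

  -- The minimum is attained at some pair, and the packing supplied for that pair bounds its `λₛ`
  -- from below.
  λ₂-greatest : ∀ {k} → (∀ u v → u ≢ v → ArcDisjointPacking (Arc D) u v (Fin k)) → k ≤ λ₂ D
  λ₂-greatest {k} packings with proj₁ (λ₂-isMinimum D)
  ... | S , ∣S∣≡2 , λₛ≡λ₂ with ∣p∣≡2⇒p≡⁅x⁆∪⁅y⁆ S ∣S∣≡2
  ...   | u , v , u≢v , refl = subst (k ≤_) λₛ≡λ₂
    (proj₂ (λₛ-isMaximum D S ∣S∣≡2) k (toPacking {D} (packings u v u≢v)))

  strong⇒1≤λ₂ : Strong D → 1 ≤ λ₂ D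
  strong⇒1≤λ₂ s = λ₂-greatest λ _ _ _ → record
    { member   = λ _ → whole D s
    ; left     = λ _ → tt
    ; right    = λ _ → tt
    ; disjoint = λ { {zero} {zero} _ _ → refl }
    }

  1≤λ₂⇒strong : 1 ≤ λ₂ D → Strong D
  1≤λ₂⇒strong 1≤λ₂ u v _ _ with u ≟ v
  ... | yes refl = ε
  ... | no  u≢v  = Star-map (arc F) (strong F (left P i) (right P i))
    where
    P = λ₂-packing u v u≢v
    i = inject≤ zero 1≤λ₂
    F = member P i

  -- Members of a packing for `u` and another vertex leave `u` by distinct arcs, so each uses up its
  -- own entry of `neighbour`.
  λ₂≤out-degree : ∀ {d} u (neighbour : Fin d → Fin (order D)) →
                  (∀ w → Arc D u w → ∃[ k ] neighbour k ≡ w) → λ₂ D ≤ d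
  λ₂≤out-degree u neighbour covers = injective⇒≤ {f = λ i → proj₁ (cover i)}
    λ {i} {j} eq → out-injective
      (trans (sym (proj₂ (cover i))) (trans (cong neighbour eq) (proj₂ (cover j))))
    where
    open OutNeighbours {E = Arc D} (proj₂ (other-vertex u)) (λ₂-packing u _ (proj₂ (other-vertex u)))
    cover : ∀ i → ∃[ k ] neighbour k ≡ out i
    cover i = covers (out i) (out-arc∈E i)

-- Cartesian products

-- The conditions under which the subgraphs of a packing placed on the lines c₁
-- and c₂ parallel to one factor, together with full bridges on the lines w j,
-- may be distributed among new subgraphs by σ₁, σ₂ and τ without sharing arcs.
record Allocation {X I J : Set} (C K : Set) (B : I → Rel X 0ℓ) (w : J → C) : Set where
  field
    same-member  : ∀ {i j p q} → B i p q → B j p q → i ≡ j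
    c₁ c₂        : C
    σ₁ σ₂        : I → K
    τ            : J → K
    σ-agree      : c₁ ≡ c₂ → ∀ i → σ₁ i ≡ σ₂ i
    w-injective  : ∀ {i j} → w i ≡ w j → i ≡ j
    w≢c₁         : ∀ j → w j ≢ c₁
    w≢c₂         : ∀ j → w j ≢ c₂

  -- The last index is the subgraph to which the pair `p`, `q` on line `c` is allotted. A bridge
  -- takes every pair on its line, since it uses a whole fibre.
  data Claim (c : C) (p q : X) : K → Set where
    first  : ∀ i → c ≡ c₁ → B i p q → Claim c p q (σ₁ i)
    second : ∀ i → c ≡ c₂ → B i p q → Claim c p q (σ₂ i)
    bridge : ∀ j → c ≡ w j → Claim c p q (τ j)

  unique : ∀ {c p q k l} → Claim c p q k → Claim c p q l → k ≡ l
  unique (first  i _  a) (first  j _  b) = cong σ₁ (same-member a b)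
  unique (second i _  a) (second j _  b) = cong σ₂ (same-member a b)
  unique (bridge i e)    (bridge j e′)   = cong τ (w-injective (trans (sym e) e′))
  -- Here `c₁` and `c₂` coincide, so the two copies of a member are one and must have the same
  -- owner.
  unique (first  i e  a) (second j e′ b) =
    trans (σ-agree (trans (sym e) e′) i) (cong σ₂ (same-member a b))
  unique (second i e  a) (first  j e′ b) =
    sym (trans (σ-agree (trans (sym e′) e) j) (cong σ₂ (same-member b a)))
  unique (first  i e  _) (bridge j e′)   = ⊥-elim (w≢c₁ j (trans (sym e′) e))
  unique (second i e  _) (bridge j e′)   = ⊥-elim (w≢c₂ j (trans (sym e′) e))
  unique (bridge j e′)   (first  i e  _) = ⊥-elim (w≢c₁ j (trans (sym e′) e))
  unique (bridge j e′)   (second i e  _) = ⊥-elim (w≢c₂ j (trans (sym e′) e))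

open Allocation using (first; second; bridge)

-- The arcs of G □ H before the identification of pairs with Fin (m * n).
□-Arcs : (G H : Digraph) → Rel (Fin (order G) × Fin (order H)) 0ℓ
□-Arcs G H (x , x′) (y , y′) = (Arc G x y × x′ ≡ y′) ⊎ (x ≡ y × Arc H x′ y′)

□-Arcs-swap : ∀ {G H u v} → □-Arcs H G (swap u) (swap v) → □-Arcs G H u v
□-Arcs-swap (inj₁ (a , eq)) = inj₂ (eq , a)
□-Arcs-swap (inj₂ (eq , a)) = inj₁ (a , eq)

row : ∀ {G H} → StrongSubgraph (Arc G) → Fin (order H) → StrongSubgraph (□-Arcs G H)
row F c = record
  { V  = λ (p , p′) → V F p × p′ ≡ c
  ; A  = λ (p , p′) (q , q′) → A F p q × p′ ≡ c × q′ ≡ c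
  ; V? = λ (p , p′) → V? F p ×-dec (p′ ≟ c)
  ; A? = λ (p , p′) (q , q′) → A? F p q ×-dec ((p′ ≟ c) ×-dec (q′ ≟ c))
  ; arc    = λ (a , e , e′) → inj₁ (arc F a , trans e (sym e′))
  ; source = λ (a , e , _) → source F a , e
  ; target = λ (a , _ , e) → target F a , e
  ; strong = λ { (p , refl) (q , refl) → gmap (_, c) (λ a → a , refl , refl) (strong F p q) }
  }

column : ∀ {G H} → StrongSubgraph (Arc H) → Fin (order G) → StrongSubgraph (□-Arcs G H)
column {G} {H} K c = pullback (×-comm _ _) (□-Arcs-swap {G} {H}) (row {H} {G} K c)

module _ {G H : Digraph} {K I J I′ J′ : Set}
         {B : I → Rel (Fin (order G)) 0ℓ} {w : J → Fin (order H)}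
         {B′ : I′ → Rel (Fin (order H)) 0ℓ} {w′ : J′ → Fin (order G)}
         (rows : Allocation (Fin (order H)) K B w) (columns : Allocation (Fin (order G)) K B′ w′) where

  private
    module R = Allocation rows
    module C = Allocation columns

  -- An arc of the product moves exactly one coordinate. Recording which one keeps claims along rows
  -- apart from claims along columns.
  OwnedBy : K → Rel (Fin (order G) × Fin (order H)) 0ℓ
  OwnedBy k (p , p′) (q , q′) =
    (p ≢ q × p′ ≡ q′ × R.Claim p′ p q k) ⊎ (p ≡ q × p′ ≢ q′ × C.Claim p p′ q′ k)

  owner-unique : ∀ {k l u v} → OwnedBy k u v → OwnedBy l u v → k ≡ l
  owner-unique (inj₁ (_ , _ , a)) (inj₁ (_ , _ , b)) = R.unique a b
  owner-unique (inj₂ (_ , _ , a)) (inj₂ (_ , _ , b)) = C.unique a b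
  owner-unique (inj₁ (p≢q , _))   (inj₂ (p≡q , _))   = ⊥-elim (p≢q p≡q)
  owner-unique (inj₂ (p≡q , _))   (inj₁ (p≢q , _))   = ⊥-elim (p≢q p≡q)

  owned-row : ∀ {k c u v} (F : StrongSubgraph (Arc G)) →
              (∀ {p q} → A F p q → R.Claim c p q k) → A (row {G} {H} F c) u v → OwnedBy k u v
  owned-row F claim (a , refl , refl) =
    inj₁ ((λ p≡q → no-loop G p≡q (arc F a)) , refl , claim a)

  owned-column : ∀ {k c u v} (F : StrongSubgraph (Arc H)) →
                 (∀ {p q} → A F p q → C.Claim c p q k) → A (column {G} {H} F c) u v → OwnedBy k u v
  owned-column F claim (a , refl , refl) =
    inj₂ (refl , (λ p≡q → no-loop H p≡q (arc F a)) , claim a)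

-- Packings in the product of two strong digraphs

module ProductPacking {G H : Digraph} (sG : Strong G) (sH : Strong H) where

  -- Since `F` contains `z`, the fibre of `H` over `z` meets both copies of `F`, at `(z , c₁)` and
  -- `(z , c₂)`.
  row-bridge : ∀ F c₁ c₂ z → V F z → StrongSubgraph (□-Arcs G H)
  row-bridge F c₁ c₂ z z∈F = join-at (z , c₁) (row {G} {H} F c₁)
    (join-at (z , c₂) (column {G} {H} (whole H sH) z) (row {G} {H} F c₂) (tt , refl) (z∈F , refl))
    (z∈F , refl) (inj₁ (tt , refl))

  column-bridge : ∀ K c₁ c₂ z → V K z → StrongSubgraph (□-Arcs G H)
  column-bridge K c₁ c₂ z z∈K = join-at (c₁ , z) (column {G} {H} K c₁)
    (join-at (c₂ , z) (row {G} {H} (whole G sG) z) (column {G} {H} K c₂) (tt , refl) (z∈K , refl))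
    (z∈K , refl) (inj₁ (tt , refl))

  -- The vertex `t` only ensures that each member of `P` has an arc leaving `x`; the heads of these
  -- arcs carry the bridges.
  fibre-packing : ∀ {a b x t x′ y′} → x ≢ t →
    ArcDisjointPacking (Arc G) x t (Fin a) → ArcDisjointPacking (Arc H) x′ y′ (Fin b) →
    ArcDisjointPacking (□-Arcs G H) (x , x′) (x , y′) (Fin a ⊎ Fin b)
  fibre-packing {a} {b} {x} {t} {x′} {y′} x≢t P Q = record
    { member   = part-of
    ; left     = λ { (inj₁ i) → inj₁ (left P i , refl) ; (inj₂ j) → left Q j , refl }
    ; right    = λ { (inj₁ i) → inj₂ (inj₂ (left P i , refl)) ; (inj₂ j) → right Q j , refl }
    ; disjoint = λ {k} {l} α β → owner-unique {G} {H} rows columns (owned k α) (owned l β)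
    }
    where
    open OutNeighbours {E = Arc G} x≢t P

    part-of : Fin a ⊎ Fin b → StrongSubgraph (□-Arcs G H)
    part-of (inj₁ i) = row-bridge (member P i) x′ y′ (out i) (out∈ i)
    part-of (inj₂ j) = column {G} {H} (member Q j) x

    -- No bridge runs along a row, hence the empty index type. Both copies of a member of `P` go to
    -- the same subgraph.
    rows : Allocation (Fin (order H)) (Fin a ⊎ Fin b) (λ i → A (member P i)) (λ (j : ∅) → ⊥-elim j)
    rows = record
      { same-member = disjoint P
      ; c₁ = x′ ; c₂ = y′ ; σ₁ = inj₁ ; σ₂ = inj₁ ; τ = λ () ; σ-agree = λ _ _ → refl
      ; w-injective = λ {} ; w≢c₁ = λ () ; w≢c₂ = λ ()
      }

    out≢x : ∀ i → out i ≢ x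
    out≢x i eq = no-loop G (sym eq) (out-arc∈E i)

    -- The members of `Q` all lie in the single fibre over `x`, which the bridges avoid because `G`
    -- has no loops.
    columns : Allocation (Fin (order G)) (Fin a ⊎ Fin b) (λ j → A (member Q j)) out
    columns = record
      { same-member = disjoint Q
      ; c₁ = x ; c₂ = x ; σ₁ = inj₂ ; σ₂ = inj₂ ; τ = inj₁ ; σ-agree = λ _ _ → refl
      ; w-injective = out-injective ; w≢c₁ = out≢x ; w≢c₂ = out≢x
      }

    owned : ∀ k {u v} → A (part-of k) u v → OwnedBy {G} {H} rows columns k u v
    owned (inj₁ i) (inj₁ α)        = owned-row {G} {H} rows columns (member P i) (first i refl) α
    owned (inj₁ i) (inj₂ (inj₁ α)) = owned-column {G} {H} rows columns (whole H sH) (λ _ → bridge i refl) α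
    owned (inj₁ i) (inj₂ (inj₂ α)) = owned-row {G} {H} rows columns (member P i) (second i refl) α
    owned (inj₂ j) α               = owned-column {G} {H} rows columns (member Q j) (first j refl) α

  diagonal-packing : ∀ {a b x y x′ y′} → x ≢ y → x′ ≢ y′ →
    ArcDisjointPacking (Arc G) x y (Fin (suc a)) → ArcDisjointPacking (Arc H) x′ y′ (Fin (suc b)) →
    ArcDisjointPacking (□-Arcs G H) (x , x′) (y , y′) (Fin (suc a) ⊎ Fin (suc b))
  diagonal-packing {a} {b} {x} {y} {x′} {y′} x≢y x′≢y′ P₀ Q₀ = record
    { member   = part-of
    ; left     = λ where
        (inj₁ zero)    → inj₁ (left P zero , refl)
        (inj₁ (suc i)) → inj₁ (left P (suc i) , refl)
        (inj₂ zero)    → inj₂ (left Q zero , refl)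
        (inj₂ (suc j)) → inj₁ (left Q (suc j) , refl)
    ; right    = λ where
        (inj₁ zero)    → inj₂ (right Q zero , refl)
        (inj₁ (suc i)) → inj₂ (inj₂ (right P (suc i) , refl))
        (inj₂ zero)    → inj₁ (right P zero , refl)
        (inj₂ (suc j)) → inj₂ (inj₂ (right Q (suc j) , refl))
    ; disjoint = λ {k} {l} α β → owner-unique {G} {H} rows columns (owned k α) (owned l β)
    }
    where
    P = proj₁ (isolate-arc P₀)
    Q = proj₁ (isolate-arc Q₀)
    module OP = OutNeighbours {E = Arc G} x≢y P
    module OQ = OutNeighbours {E = Arc H} x′≢y′ Q

    Index = Fin (suc a) ⊎ Fin (suc b)

    part-of : Index → StrongSubgraph (□-Arcs G H)
    -- The two combined subgraphs are joined at the opposite corners `(y , x′)` and `(x , y′)` of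
    -- the rectangle spanned by the two given vertices.
    part-of (inj₁ zero) = join-at (y , x′)
      (row {G} {H} (member P zero) x′) (column {G} {H} (member Q zero) y)
      (right P zero , refl) (left Q zero , refl)
    part-of (inj₂ zero) = join-at (x , y′)
      (row {G} {H} (member P zero) y′) (column {G} {H} (member Q zero) x)
      (left P zero , refl) (right Q zero , refl)
    part-of (inj₁ (suc i)) =
      row-bridge (member P (suc i)) x′ y′ (OP.out (suc i)) (OP.out∈ (suc i))
    part-of (inj₂ (suc j)) =
      column-bridge (member Q (suc j)) x y (OQ.out (suc j)) (OQ.out∈ (suc j))

    -- Only member `zero` has its two copies in different subgraphs: height `x′` goes to
    -- `inj₁ zero`, height `y′` to `inj₂ zero`.
    σᴾ σᴾ′ : Fin (suc a) → Index
    σᴾ = inj₁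
    σᴾ′ zero    = inj₂ zero
    σᴾ′ (suc i) = inj₁ (suc i)

    -- The assignment is crossed: over `x` member `zero` goes to `inj₂ zero`, over `y` to
    -- `inj₁ zero`.
    σᵠ σᵠ′ : Fin (suc b) → Index
    σᵠ = inj₂
    σᵠ′ zero    = inj₁ zero
    σᵠ′ (suc j) = inj₂ (suc j)

    rows : Allocation (Fin (order H)) Index (λ i → A (member P i)) (λ j → OQ.out (suc j))
    rows = record
      { same-member = disjoint P
      ; c₁ = x′ ; c₂ = y′ ; σ₁ = σᴾ ; σ₂ = σᴾ′ ; τ = λ j → inj₂ (suc j)
      ; σ-agree     = λ eq → ⊥-elim (x′≢y′ eq)
      ; w-injective = λ eq → suc-injectiveᶠ (OQ.out-injective eq)
      ; w≢c₁        = λ j eq → no-loop H (sym eq) (OQ.out-arc∈E (suc j))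
      -- A bridge at height `y′` would put the arc from `x′` to `y′` in a member other than `zero`,
      -- which `isolate-arc` excludes.
      ; w≢c₂        = λ j eq → proj₂ (isolate-arc Q₀) j
          (subst (A (member Q (suc j)) x′) eq (proj₂ (OQ.out-arc (suc j))))
      }

    columns : Allocation (Fin (order G)) Index (λ j → A (member Q j)) (λ i → OP.out (suc i))
    columns = record
      { same-member = disjoint Q
      ; c₁ = x ; c₂ = y ; σ₁ = σᵠ ; σ₂ = σᵠ′ ; τ = λ i → inj₁ (suc i)
      ; σ-agree     = λ eq → ⊥-elim (x≢y eq)
      ; w-injective = λ eq → suc-injectiveᶠ (OP.out-injective eq)
      ; w≢c₁        = λ i eq → no-loop G (sym eq) (OP.out-arc∈E (suc i))
      ; w≢c₂        = λ i eq → proj₂ (isolate-arc P₀) i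
          (subst (A (member P (suc i)) x) eq (proj₂ (OP.out-arc (suc i))))
      }

    by-row = owned-row {G} {H} rows columns
    by-column = owned-column {G} {H} rows columns

    owned : ∀ k {u v} → A (part-of k) u v → OwnedBy {G} {H} rows columns k u v
    owned (inj₁ zero) (inj₁ α) = by-row (member P zero) (first zero refl) α
    owned (inj₁ zero) (inj₂ α) = by-column (member Q zero) (second zero refl) α
    owned (inj₂ zero) (inj₁ α) = by-row (member P zero) (second zero refl) α
    owned (inj₂ zero) (inj₂ α) = by-column (member Q zero) (first zero refl) α
    owned (inj₁ (suc i)) (inj₁ α)        = by-row (member P (suc i)) (first (suc i) refl) α
    owned (inj₁ (suc i)) (inj₂ (inj₁ α)) = by-column (whole H sH) (λ _ → bridge i refl) α
    owned (inj₁ (suc i)) (inj₂ (inj₂ α)) = by-row (member P (suc i)) (second (suc i) refl) α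
    owned (inj₂ (suc j)) (inj₁ α)        = by-column (member Q (suc j)) (first (suc j) refl) α
    owned (inj₂ (suc j)) (inj₂ (inj₁ α)) = by-row (whole G sG) (λ _ → bridge j refl) α
    owned (inj₂ (suc j)) (inj₂ (inj₂ α)) = by-column (member Q (suc j)) (second (suc j) refl) α

-- The lower bound

module _ (G H : Digraph) .{{_ : NonTrivial (order G)}} .{{_ : NonTrivial (order H)}} where

  □-Arcs-packing : ∀ {a b} → Strong G → Strong H → 1 ≤ a → 1 ≤ b →
    (∀ u v → u ≢ v → ArcDisjointPacking (Arc G) u v (Fin a)) →
    (∀ u v → u ≢ v → ArcDisjointPacking (Arc H) u v (Fin b)) →
    ∀ u v → u ≢ v → ArcDisjointPacking (□-Arcs G H) u v (Fin a ⊎ Fin b)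
  -- Matching makes `a` and `b` successors, so that each packing has a member `zero` to set aside in
  -- the diagonal case.
  □-Arcs-packing sG sH (s≤s _) (s≤s _) P Q (x , x′) (y , y′) u≢v with x ≟ y | x′ ≟ y′
  ... | yes refl | yes refl  = ⊥-elim (u≢v refl)
  ... | yes refl | no  x′≢y′ =
    let t , x≢t = other-vertex x
    in ProductPacking.fibre-packing {G} {H} sG sH x≢t (P x t x≢t) (Q x′ y′ x′≢y′)
  ... | no  x≢y  | yes refl  =
    let t , x′≢t = other-vertex x′
    in pullback-packing (×-comm _ _) (□-Arcs-swap {G} {H}) (reindex (↔⇒↣ (⊎-comm _ _))
         (ProductPacking.fibre-packing {H} {G} sH sG x′≢t (Q x′ t x′≢t) (P x y x≢y)))
  ... | no  x≢y  | no  x′≢y′ =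
    ProductPacking.diagonal-packing {G} {H} sG sH x≢y x′≢y′ (P x y x≢y) (Q x′ y′ x′≢y′)

  λ₂-□-strong : Strong G → Strong H → λ₂ G + λ₂ H ≤ λ₂ (G □ H)
  λ₂-□-strong sG sH = λ₂-greatest (G □ H) λ u v u≢v →
    -- The arcs of `G □ H` are by definition those of `□-Arcs` between the decoded pairs, whence
    -- `id`.
    pullback-packing *↔× id (reindex (↔⇒↣ +↔⊎)
      (□-Arcs-packing sG sH (strong⇒1≤λ₂ G sG) (strong⇒1≤λ₂ H sH) (λ₂-packing G) (λ₂-packing H)
        _ _ (u≢v ∘ Injection.injective (↔⇒↣ *↔×))))

  λ₂-□ : Strong G ⇔ Strong H → λ₂ (G □ H) ≥ λ₂ G + λ₂ H
  λ₂-□ G⇔H with 1 ≤? λ₂ G | 1 ≤? λ₂ H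
  ... | yes 1≤λG | _ = let sG = 1≤λ₂⇒strong G 1≤λG in λ₂-□-strong sG (Equivalence.to G⇔H sG)
  ... | _ | yes 1≤λH = let sH = 1≤λ₂⇒strong H 1≤λH in λ₂-□-strong (Equivalence.from G⇔H sH) sH
  -- Both summands are zero.
  ... | no 1≰λG | no 1≰λH =
    ≤-trans (+-mono-≤ (≤-pred (≰⇒> 1≰λG)) (≤-pred (≰⇒> 1≰λH))) z≤n

-- Sharpness

K₂ : Digraph
K₂ = record { order = 2 ; Arc = _≢_ ; arc? = λ u v → ¬? (u ≟ v) ; no-loop = λ u≡v u≢v → u≢v u≡v }

K₂-strong : Strong K₂
K₂-strong u v _ _ with u ≟ v
... | yes refl = ε
... | no  u≢v  = u≢v ◅ ε

-- The instance is given by hand because *-nonTrivial makes instance search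
-- diverge at the numeral 4.
λ₂[K₂□K₂]≤2 : λ₂ (K₂ □ K₂) {{_}} ≤ 2
λ₂[K₂□K₂]≤2 = λ₂≤out-degree (K₂ □ K₂) {{_}} 0F (lookup (1F ∷ 2F ∷ [])) λ where
  -- The product is the bidirected 4-cycle: `0F` is (0,0), its out-neighbours `1F` and `2F` are
  -- (0,1) and (1,0), and `3F` is the opposite corner.
  0F a → ⊥-elim (no-loop (K₂ □ K₂) {0F} refl a)
  1F _ → 0F , refl
  2F _ → 1F , refl
  3F (inj₁ (_ , ()))
  3F (inj₂ (() , _))

theorem4p8 :
    ((G H : Digraph) .{{_ : NonTrivial (order G)}} .{{_ : NonTrivial (order H)}} →
       Strong G ⇔ Strong H →
       λ₂ (G □ H) ≥ λ₂ G + λ₂ H)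
    ×
    (Σ[ G ∈ Digraph ] Σ[ H ∈ Digraph ]
       Σ[ nG ∈ NonTrivial (order G) ] Σ[ nH ∈ NonTrivial (order H) ]
         (let instance _ = nG
                       _ = nH
          in Strong G × Strong H × λ₂ (G □ H) ≡ λ₂ G + λ₂ H))
theorem4p8 =
  (λ G H → λ₂-□ G H) ,
  K₂ , K₂ , _ , _ , K₂-strong , K₂-strong ,
  -- Strength gives each factor `λ₂` at least 1, so 2 is at most the sum; the exact value of `λ₂ K₂`
  -- is never computed.
  ≤-antisym (≤-trans λ₂[K₂□K₂]≤2 (+-mono-≤ 1≤λ₂[K₂] 1≤λ₂[K₂])) (λ₂-□-strong K₂ K₂ {{_}} {{_}} K₂-strong K₂-strong)
  where
  1≤λ₂[K₂] : 1 ≤ λ₂ K₂ {{_}}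
  1≤λ₂[K₂] = strong⇒1≤λ₂ K₂ {{_}} K₂-strong
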